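{- For nominal sets $X,Y$, the substitution tensor $X\diamond Y=\int^{A\in\mathbb{I}}\mathbf{Nom}(\mathbb{A}^{*A},X)\cdot Y^{*A}$ is given by $$X\diamond Y=\{(x,\gamma)\mid x\in X,\ \gamma\in Y^{*\operatorname{supp}x}\}/\sim,\qquad (\pi\cdot x,\gamma)\sim(x,\gamma\pi)\quad\text{for }x\in X,\ \pi\in\mathrm{Perm}\,\mathbb{A},\ \gamma\in Y^{*\operatorname{supp}(\pi\cdot x)}.$$ Writing $x[\gamma]$ for the equivalence class of $(x,\gamma)$, the $\mathrm{Perm}\,\mathbb{A}$-action and least supports of elements of $X\diamond Y$ are given by $$\pi\cdot x[\gamma]=x[\pi\cdot\gamma],\qquad \operatorname{supp}x[\gamma]=\operatorname{supp}\gamma=\bigcup_{a\in\operatorname{supp}x}\operatorname{supp}\gamma(a).$$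
   Context: $\mathbb{A}$ is a countably infinite set of names and $\mathrm{Perm}\,\mathbb{A}$ the group of finite permutations of $\mathbb{A}$. A nominal set is a $\mathrm{Perm}\,\mathbb{A}$-set $X$ in which every $x\in X$ has a finite support: a finite $S\subseteq\mathbb{A}$ such that every $\pi$ fixing $S$ pointwise satisfies $\pi\cdot x=x$. Then $x$ has a least finite support $\operatorname{supp}x$. $\mathbf{Nom}$ is the category of nominal sets and equivariant maps; it is cocomplete, and $S\cdot X$ denotes the copower $\coprod_{s\in S}X$ of a nominal set $X$ by a set $S$. Write $x\#y$ if $\operatorname{supp}x\cap\operatorname{supp}y=\emptyset$. $\mathbb{I}$ is the category of finite sets and injections (identified with the equivalent small category of finite subsets of $\mathbb{A}$). For a nominal set $Y$ and a finite set $A$, $Y^{*A}=\{f\colon A\to Y\mid a\ne b\Rightarrow f(a)\#f(b)\}$ with pointwise action $(\pi\cdot f)(a)=\pi\cdot f(a)$; this is a nominal set, contravariantly functorial in $A\in\mathbb{I}$ by precomposition. In particular $\mathbb{A}^{*A}$ (with $\mathbb{A}$ carrying the action $\pi\cdot a=\pi(a)$) gives a functor $\psi\colon\mathbb{I}^{\mathrm{op}}\to\mathbf{Nom}$, $\psi A=\mathbb{A}^{*A}$, and $A\mapsto\mathbf{Nom}(\mathbb{A}^{*A},X)$ is a covariant presheaf on $\mathbb{I}$. In the relation $\sim$, $\gamma\pi\in Y^{*\operatorname{supp}x}$ denotes $a\mapsto\gamma(\pi(a))$ (note $\operatorname{supp}(\pi\cdot x)=\pi[\operatorname{supp}x]$).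 "Is given by" means up to (natural) isomorphism of nominal sets. -}

module Defs where

open import Algebra.Bundles using (Group)
open import Data.List.Base using (List; []; _∷_; _++_; map; concat)
open import Data.List.Membership.Propositional using (_∈_; _∉_; mapWith∈)
open import Data.List.Membership.Propositional.Properties
  using (∈-++⁺ˡ; ∈-++⁺ʳ; ∈-map⁺; ∈-map⁻)
open import Data.List.Relation.Unary.Any using (here; there)
open import Data.Product.Base using (Σ; Σ-syntax; ∃; ∃-syntax; _×_; _,_; proj₁; proj₂)
open import Data.Product.Relation.Binary.Pointwise.NonDependent using (×-setoid)
open import Function.Base using (id; _∘_)
open import Function.Bundles using (Func; Inverse; _↔_)
open import Function.Properties.Inverse using (↔-refl; ↔-sym; ↔-trans)
open import Level using (Level; suc; _⊔_)
open import Relation.Binary.Bundles using (Setoid)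
open import Relation.Binary.Structures using (IsEquivalence)
open import Relation.Binary.PropositionalEquality as ≡ using (_≡_; _≢_; refl)
import Relation.Binary.Reasoning.Setoid as SetoidReasoning
open import Relation.Unary using (Pred; _⊆_; _≐_; _⊥_)

------------------------------------------------------------------------
-- Categories with setoids of morphisms, and coends

record Category (o h : Level) : Set (suc (o ⊔ h)) where
  infixr 9 _⊚_
  field
    Obj    : Set o
    Hom    : Obj → Obj → Setoid h h

  infixr 0 _⇒_
  infix  4 _≈_
  _⇒_ : Obj → Obj → Set h
  A ⇒ B = Setoid.Carrier (Hom A B)

  _≈_ : ∀ {A B} → A ⇒ B → A ⇒ B → Set h
  _≈_ {A} {B} = Setoid._≈_ (Hom A B)

  field
    idm       : ∀ {A} → A ⇒ A
    _⊚_       : ∀ {A B C} → B ⇒ C → A ⇒ B → A ⇒ C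
    ⊚-cong    : ∀ {A B C} {f f′ : B ⇒ C} {g g′ : A ⇒ B} →
                f ≈ f′ → g ≈ g′ → f ⊚ g ≈ f′ ⊚ g′
    identityˡ : ∀ {A B} (f : A ⇒ B) → idm ⊚ f ≈ f
    identityʳ : ∀ {A B} (f : A ⇒ B) → f ⊚ idm ≈ f
    assoc     : ∀ {A B C D} (f : C ⇒ D) (g : B ⇒ C) (h : A ⇒ B) →
                (f ⊚ g) ⊚ h ≈ f ⊚ (g ⊚ h)

Op : ∀ {o h} → Category o h → Category o h
Op C = record
  { Obj       = Obj
  ; Hom       = λ A B → Hom B A
  ; idm       = idm
  ; _⊚_       = λ f g → g ⊚ f
  ; ⊚-cong    = λ p q → ⊚-cong q p
  ; identityˡ = identityʳ
  ; identityʳ = identityˡ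
  ; assoc     = λ {A} {B} {C} {D} f g h → Setoid.sym (Hom D A) (assoc h g f)
  }
  where open Category C

infixr 2 _×ᶜ_
_×ᶜ_ : ∀ {o h o′ h′} → Category o h → Category o′ h′ → Category (o ⊔ o′) (h ⊔ h′)
C ×ᶜ D = record
  { Obj       = C.Obj × D.Obj
  ; Hom       = λ (A , A′) (B , B′) → ×-setoid (C.Hom A B) (D.Hom A′ B′)
  ; idm       = C.idm , D.idm
  ; _⊚_       = λ (f , f′) (g , g′) → f C.⊚ g , f′ D.⊚ g′
  ; ⊚-cong    = λ (p , p′) (q , q′) → C.⊚-cong p q , D.⊚-cong p′ q′
  ; identityˡ = λ (f , f′) → C.identityˡ f , D.identityˡ f′
  ; identityʳ = λ (f , f′) → C.identityʳ f , D.identityʳ f′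
  ; assoc     = λ (f , f′) (g , g′) (h , h′) → C.assoc f g h , D.assoc f′ g′ h′
  }
  where
  module C = Category C
  module D = Category D

record Functor {o h o′ h′} (C : Category o h) (D : Category o′ h′)
       : Set (o ⊔ h ⊔ o′ ⊔ h′) where
  private
    module C = Category C
    module D = Category D
  field
    F₀     : C.Obj → D.Obj
    F₁     : ∀ {A B} → A C.⇒ B → F₀ A D.⇒ F₀ B
    F-cong : ∀ {A B} {f g : A C.⇒ B} → f C.≈ g → F₁ f D.≈ F₁ g
    F-id   : ∀ {A} → F₁ (C.idm {A}) D.≈ D.idm
    F-∘    : ∀ {A B E} (f : B C.⇒ E) (g : A C.⇒ B) → F₁ (f C.⊚ g) D.≈ F₁ f D.⊚ F₁ g

module _ {o h o′ h′} {C : Category o h} {D : Category o′ h′}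
         (F : Functor (Op C ×ᶜ C) D) where
  private
    module C = Category C
    module D = Category D
  open Functor F

  record Cowedge (d : D.Obj) : Set (o ⊔ h ⊔ h′) where
    field
      ω         : ∀ A → F₀ (A , A) D.⇒ d
      dinatural : ∀ {A B} (j : A C.⇒ B) →
                  ω A D.⊚ F₁ (j , C.idm) D.≈ ω B D.⊚ F₁ (C.idm , j)

  record IsCoend (d : D.Obj) (W : Cowedge d) : Set (o ⊔ h ⊔ o′ ⊔ h′) where
    open Cowedge
    field
      factor   : ∀ {z} → Cowedge z → d D.⇒ z
      commutes : ∀ {z} (V : Cowedge z) A → factor V D.⊚ ω W A D.≈ ω V A
      unique   : ∀ {z} (V : Cowedge z) (k : d D.⇒ z) →
                 (∀ A → k D.⊚ ω W A D.≈ ω V A) → k D.≈ factor V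

------------------------------------------------------------------------

module Nominal {ℓ : Level} (𝔸 : Set ℓ) where

  -- Finite permutations

  record Perm : Set ℓ where
    field
      bijection : 𝔸 ↔ 𝔸
      finite    : ∃[ S ] ∀ {a} → a ∉ S → Inverse.to bijection a ≡ a

    infixr 10 _⟨$⟩_ _⟨$⟩⁻¹_
    _⟨$⟩_ : 𝔸 → 𝔸
    _⟨$⟩_ = Inverse.to bijection

    _⟨$⟩⁻¹_ : 𝔸 → 𝔸
    _⟨$⟩⁻¹_ = Inverse.from bijection

    inverseˡ : ∀ a → _⟨$⟩⁻¹_ (_⟨$⟩_ a) ≡ a
    inverseˡ = Inverse.strictlyInverseʳ bijection

    inverseʳ : ∀ a → _⟨$⟩_ (_⟨$⟩⁻¹_ a) ≡ a
    inverseʳ = Inverse.strictlyInverseˡ bijection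

  open Perm using (_⟨$⟩_; _⟨$⟩⁻¹_; inverseˡ; inverseʳ)

  idₚ : Perm
  idₚ = record { bijection = ↔-refl ; finite = [] , λ _ → refl }

  infixr 9 _∘ₚ_
  _∘ₚ_ : Perm → Perm → Perm
  σ ∘ₚ π = record
    { bijection = ↔-trans (Perm.bijection π) (Perm.bijection σ)
    ; finite    = proj₁ (Perm.finite π) ++ proj₁ (Perm.finite σ) , λ a∉ →
        ≡.trans (≡.cong (σ ⟨$⟩_) (proj₂ (Perm.finite π) (a∉ ∘ ∈-++⁺ˡ)))
                (proj₂ (Perm.finite σ) (a∉ ∘ ∈-++⁺ʳ _))
    }

  infix 11 _⁻¹ₚ
  _⁻¹ₚ : Perm → Perm
  π ⁻¹ₚ = record
    { bijection = ↔-sym (Perm.bijection π)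
    ; finite    = proj₁ (Perm.finite π) , λ {a} a∉ →
        ≡.trans (≡.cong (π ⟨$⟩⁻¹_) (≡.sym (proj₂ (Perm.finite π) a∉))) (inverseˡ π a)
    }

  PermGroup : Group ℓ ℓ
  PermGroup = record
    { Carrier = Perm
    ; _≈_     = λ π σ → ∀ a → π ⟨$⟩ a ≡ σ ⟨$⟩ a
    ; _∙_     = _∘ₚ_
    ; ε       = idₚ
    ; _⁻¹     = _⁻¹ₚ
    ; isGroup = record
      { isMonoid = record
        { isSemigroup = record
          { isMagma = record
            { isEquivalence = record
              { refl  = λ _ → refl
              ; sym   = λ p a → ≡.sym (p a)
              ; trans = λ p q a → ≡.trans (p a) (q a)
              }
            ; ∙-cong = λ {π} {π′} {σ} {σ′} p q a →
                ≡.trans (≡.cong (π ⟨$⟩_) (q a)) (p (σ′ ⟨$⟩ a))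
            }
          ; assoc = λ _ _ _ _ → refl
          }
        ; identity = (λ _ _ → refl) , (λ _ _ → refl)
        }
      ; inverse = inverseˡ , inverseʳ
      ; ⁻¹-cong = λ {π} {σ} p a →
          ≡.trans (≡.cong (π ⟨$⟩⁻¹_)
                    (≡.trans (≡.sym (inverseʳ σ a)) (≡.sym (p (σ ⟨$⟩⁻¹ a)))))
                  (inverseˡ π (σ ⟨$⟩⁻¹ a))
      }
    }

  open Group PermGroup using () renaming (_≈_ to _≈ₚ_)

  ----------------------------------------------------------------------
  -- Sets with a Perm 𝔸-action, and supports

  record PermSet : Set (suc ℓ) where
    infixr 8 _·_
    field
      setoid : Setoid ℓ ℓ

    open Setoid setoid public
      using (Carrier; _≈_; isEquivalence)
      renaming (refl to ≈-refl; sym to ≈-sym; trans to ≈-trans)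

    field
      _·_    : Perm → Carrier → Carrier
      ·-cong : ∀ {π σ x y} → π ≈ₚ σ → x ≈ y → π · x ≈ σ · y
      ·-id   : ∀ x → idₚ · x ≈ x
      ·-∘    : ∀ π σ x → (π ∘ₚ σ) · x ≈ π · (σ · x)

    ·-congʳ : ∀ π {x y} → x ≈ y → π · x ≈ π · y
    ·-congʳ π = ·-cong {π} {π} (λ _ → refl)

    Supports : List 𝔸 → Carrier → Set ℓ
    Supports S x = ∀ π → (∀ {a} → a ∈ S → π ⟨$⟩ a ≡ a) → π · x ≈ x

    -- The intersection of all finite supports.  For infinite 𝔸, if x has any
    -- finite support then (classically) this is the least one.
    supp : Carrier → Pred 𝔸 ℓ
    supp x a = ∀ S → Supports S x → a ∈ S

    infix 4 _#_
    _#_ : Carrier → Carrier → Set ℓ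
    x # y = supp x ⊥ supp y

    IsLeastFiniteSupport : Pred 𝔸 ℓ → Carrier → Set ℓ
    IsLeastFiniteSupport P x =
      ∃[ S ] P ≐ (_∈ S) × Supports S x × (∀ T → Supports T x → P ⊆ (_∈ T))

    FinitelySupported : Set ℓ
    FinitelySupported = ∀ x → ∃[ S ] Supports S x

    act-inverseˡ : ∀ π x → (π ⁻¹ₚ) · (π · x) ≈ x
    act-inverseˡ π x = ≈-trans (≈-sym (·-∘ (π ⁻¹ₚ) π x))
      (≈-trans (·-cong {(π ⁻¹ₚ) ∘ₚ π} {idₚ} (inverseˡ π) ≈-refl) (·-id x))

    act-inverseʳ : ∀ π x → π · ((π ⁻¹ₚ) · x) ≈ x
    act-inverseʳ π x = ≈-trans (≈-sym (·-∘ π (π ⁻¹ₚ) x))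
      (≈-trans (·-cong {π ∘ₚ (π ⁻¹ₚ)} {idₚ} (inverseʳ π) ≈-refl) (·-id x))

    supp-· : ∀ π {x x′} → x′ ≈ π · x → ∀ a → supp x a → supp x′ (π ⟨$⟩ a)
    supp-· π {x} {x′} x′≈πx a a∈x T T-supp
      with ∈-map⁻ (π ⟨$⟩⁻¹_) (a∈x (map (π ⟨$⟩⁻¹_) T) λ σ fix → conj σ fix)
      where
      open SetoidReasoning setoid
      conj : ∀ σ → (∀ {b} → b ∈ map (π ⟨$⟩⁻¹_) T → σ ⟨$⟩ b ≡ b) → σ · x ≈ x
      conj σ fix = begin
        σ · x                                   ≈⟨ act-inverseˡ π (σ · x) ⟨
        (π ⁻¹ₚ) · π · σ · x                     ≈⟨ ·-congʳ (π ⁻¹ₚ) (begin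
          π · σ · x                             ≈⟨ ·-congʳ π (·-congʳ σ (act-inverseˡ π x)) ⟨
          π · σ · (π ⁻¹ₚ) · π · x               ≈⟨ ·-congʳ π (·-∘ σ (π ⁻¹ₚ) (π · x)) ⟨
          π · (σ ∘ₚ π ⁻¹ₚ) · π · x              ≈⟨ ·-∘ π (σ ∘ₚ π ⁻¹ₚ) (π · x) ⟨
          (π ∘ₚ σ ∘ₚ π ⁻¹ₚ) · π · x             ≈⟨ ·-congʳ (π ∘ₚ σ ∘ₚ π ⁻¹ₚ) x′≈πx ⟨
          (π ∘ₚ σ ∘ₚ π ⁻¹ₚ) · x′                ≈⟨ T-supp (π ∘ₚ σ ∘ₚ π ⁻¹ₚ) (λ {b} b∈T →
            ≡.trans (≡.cong (π ⟨$⟩_) (fix (∈-map⁺ (π ⟨$⟩⁻¹_) b∈T))) (inverseʳ π b)) ⟩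
          x′                                    ≈⟨ x′≈πx ⟩
          π · x                                 ∎) ⟩
        (π ⁻¹ₚ) · π · x                         ≈⟨ act-inverseˡ π x ⟩
        x                                       ∎
    ... | t , t∈T , refl = ≡.subst (_∈ T) (≡.sym (inverseʳ π t)) t∈T

    #-· : ∀ π {x y} → x # y → π · x # π · y
    #-· π {x} {y} x#y {a} (p , q) =
      x#y (supp-· (π ⁻¹ₚ) (≈-sym (act-inverseˡ π x)) a p ,
           supp-· (π ⁻¹ₚ) (≈-sym (act-inverseˡ π y)) a q)

  record NominalSet : Set (suc ℓ) where
    field
      permSet           : PermSet
      finitelySupported : PermSet.FinitelySupported permSet
    open PermSet permSet public

  open NominalSet using (permSet)

  private
    ∣_∣ : NominalSet → Set ℓ
    ∣ X ∣ = NominalSet.Carrier X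

  ----------------------------------------------------------------------
  -- The category Nom

  record EquivariantMap (X Y : NominalSet) : Set ℓ where
    private
      module X = NominalSet X
      module Y = NominalSet Y
    field
      func        : Func X.setoid Y.setoid
    open Func func public using (to; cong)
    field
      equivariant : ∀ π x → to (π X.· x) Y.≈ π Y.· to x

    supp-to : ∀ x → Y.supp (to x) ⊆ X.supp x
    supp-to x a∈ S S-supp = a∈ S λ π fix →
      Y.≈-trans (Y.≈-sym (equivariant π x)) (cong (S-supp π fix))

    #-to : ∀ {x x′} → x X.# x′ → to x Y.# to x′
    #-to {x} {x′} x#x′ (p , q) = x#x′ (supp-to x p , supp-to x′ q)

  open EquivariantMap using (to)

  Nom : Category (suc ℓ) ℓ
  Nom = record
    { Obj       = NominalSet
    ; Hom       = λ X Y → let open NominalSet Y in record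
      { Carrier       = EquivariantMap X Y
      ; _≈_           = λ f g → ∀ x → to f x ≈ to g x
      ; isEquivalence = record
        { refl  = λ _ → ≈-refl
        ; sym   = λ p x → ≈-sym (p x)
        ; trans = λ p q x → ≈-trans (p x) (q x)
        }
      }
    ; idm       = λ {X} → record
      { func        = record { to = id ; cong = id }
      ; equivariant = λ _ _ → NominalSet.≈-refl X
      }
    ; _⊚_       = λ {X} {Y} {Z} f g → record
      { func        = record
        { to   = to f ∘ to g
        ; cong = EquivariantMap.cong f ∘ EquivariantMap.cong g
        }
      ; equivariant = λ π x → NominalSet.≈-trans Z
          (EquivariantMap.cong f (EquivariantMap.equivariant g π x))
          (EquivariantMap.equivariant f π (to g x))
      }
    ; ⊚-cong    = λ {X} {Y} {Z} {f} {f′} {g} {g′} p q x →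
        NominalSet.≈-trans Z (EquivariantMap.cong f (q x)) (p (to g′ x))
    ; identityˡ = λ {_} {Y} _ _ → NominalSet.≈-refl Y
    ; identityʳ = λ {_} {Y} _ _ → NominalSet.≈-refl Y
    ; assoc     = λ {_} {_} {_} {W} _ _ _ _ → NominalSet.≈-refl W
    }

  open Category Nom public using () renaming (Hom to Nom[_,_]; _⊚_ to _∘ⁿ_; _≈_ to _≈ⁿ_)

  𝔸ₙ : NominalSet
  𝔸ₙ = record
    { permSet = record
      { setoid = ≡.setoid 𝔸
      ; _·_    = _⟨$⟩_
      ; ·-cong = λ { {x = a} p refl → p a }
      ; ·-id   = λ _ → refl
      ; ·-∘    = λ _ _ _ → refl
      }
    ; finitelySupported = λ a → a ∷ [] , λ _ fix → fix (here refl)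
    }

  -- The copower ∐_{s ∈ S} X: Perm 𝔸 acts trivially on the index s.
  infixr 8 _•_
  _•_ : Setoid ℓ ℓ → NominalSet → NominalSet
  S • X = record
    { permSet = record
      { setoid = ×-setoid S X.setoid
      ; _·_    = λ π (s , x) → s , π X.· x
      ; ·-cong = λ {π} {σ} p (s≈t , x≈y) → s≈t , X.·-cong {π} {σ} p x≈y
      ; ·-id   = λ (_ , x) → S.refl , X.·-id x
      ; ·-∘    = λ π σ (_ , x) → S.refl , X.·-∘ π σ x
      }
    ; finitelySupported = λ (s , x) →
        proj₁ (X.finitelySupported x) ,
        λ π fix → S.refl , proj₂ (X.finitelySupported x) π fix
    }
    where
    module X = NominalSet X
    module S = Setoid S

  ----------------------------------------------------------------------
  -- Injections between subsets of 𝔸.  An element of P is a name a together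
  -- with an unnamed proof of P a, so functions must not depend on that proof.

  record Injection (P Q : Pred 𝔸 ℓ) : Set ℓ where
    field
      fun            : ∀ a → P a → 𝔸
      mem            : ∀ a (p : P a) → Q (fun a p)
      fun-irrelevant : ∀ a (p p′ : P a) → fun a p ≡ fun a p′
      injective      : ∀ {a b} (p : P a) (q : P b) → fun a p ≡ fun b q → a ≡ b

    fun-cong : ∀ {a b} (p : P a) (q : P b) → a ≡ b → fun a p ≡ fun b q
    fun-cong {a} p q refl = fun-irrelevant a p q

  open Injection

  inclusion : ∀ {P Q : Pred 𝔸 ℓ} → P ⊆ Q → Injection P Q
  inclusion P⊆Q = record
    { fun            = λ a _ → a
    ; mem            = λ _ → P⊆Q
    ; fun-irrelevant = λ _ _ _ → refl
    ; injective      = λ _ _ → id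
    }

  infixr 9 _∘ᵢ_
  _∘ᵢ_ : ∀ {P Q R : Pred 𝔸 ℓ} → Injection Q R → Injection P Q → Injection P R
  j ∘ᵢ i = record
    { fun            = λ a p → fun j (fun i a p) (mem i a p)
    ; mem            = λ a p → mem j (fun i a p) (mem i a p)
    ; fun-irrelevant = λ a p p′ → fun-cong j (mem i a p) (mem i a p′) (fun-irrelevant i a p p′)
    ; injective      = λ p q → injective i p q ∘ injective j (mem i _ p) (mem i _ q)
    }

  -- Finite subsets of 𝔸 are presented by lists, in which order and
  -- multiplicity are immaterial: two lists with the same members are
  -- isomorphic objects.
  𝕀 : Category ℓ ℓ
  𝕀 = record
    { Obj       = List 𝔸
    ; Hom       = λ A B → record
      { Carrier       = Injection (_∈ A) (_∈ B)
      ; _≈_           = λ i j → ∀ a p → fun i a p ≡ fun j a p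
      ; isEquivalence = record
        { refl  = λ _ _ → refl
        ; sym   = λ e a p → ≡.sym (e a p)
        ; trans = λ e e′ a p → ≡.trans (e a p) (e′ a p)
        }
      }
    ; idm       = inclusion id
    ; _⊚_       = _∘ᵢ_
    ; ⊚-cong    = λ {_} {_} {_} {f} {f′} {g} {g′} p q a r →
        ≡.trans (fun-cong f (mem g a r) (mem g′ a r) (q a r)) (p (fun g′ a r) (mem g′ a r))
    ; identityˡ = λ _ _ _ → refl
    ; identityʳ = λ _ _ _ → refl
    ; assoc     = λ _ _ _ _ _ → refl
    }

  module 𝕀 = Category 𝕀

  ----------------------------------------------------------------------
  -- Y^{*P}, for an arbitrary subset P of 𝔸

  module _ (Y : NominalSet) where
    private module Y = NominalSet Y

    record StarFun (P : Pred 𝔸 ℓ) : Set ℓ where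
      field
        app        : ∀ a → P a → Y.Carrier
        irrelevant : ∀ a (p p′ : P a) → app a p Y.≈ app a p′
        fresh      : ∀ {a b} (p : P a) (q : P b) → a ≢ b → app a p Y.# app b q

      app-cong : ∀ {a b} (p : P a) (q : P b) → a ≡ b → app a p Y.≈ app b q
      app-cong {a} p q refl = irrelevant a p q

    open StarFun

    StarPermSet : Pred 𝔸 ℓ → PermSet
    StarPermSet P = record
      { setoid = record
        { Carrier       = StarFun P
        ; _≈_           = λ γ δ → ∀ a p → app γ a p Y.≈ app δ a p
        ; isEquivalence = record
          { refl  = λ _ _ → Y.≈-refl
          ; sym   = λ e a p → Y.≈-sym (e a p)
          ; trans = λ e e′ a p → Y.≈-trans (e a p) (e′ a p)
          }
        }
      ; _·_    = λ π γ → record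
        { app        = λ a p → π Y.· app γ a p
        ; irrelevant = λ a p p′ → Y.·-congʳ π (irrelevant γ a p p′)
        ; fresh      = λ p q a≢b → Y.#-· π (fresh γ p q a≢b)
        }
      ; ·-cong = λ {π} {σ} e e′ a p → Y.·-cong {π} {σ} e (e′ a p)
      ; ·-id   = λ γ a p → Y.·-id (app γ a p)
      ; ·-∘    = λ π σ γ a p → Y.·-∘ π σ (app γ a p)
      }

    Star : List 𝔸 → NominalSet
    Star A = record
      { permSet           = StarPermSet (_∈ A)
      ; finitelySupported = λ γ →
          let S : ∀ {a} → a ∈ A → List 𝔸
              S {a} p = proj₁ (Y.finitelySupported (app γ a p)) in
          concat (mapWith∈ A S) , λ π fix a p →
            proj₂ (Y.finitelySupported (app γ a p)) π (fix ∘ ∈-concatWith A S p)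
      }
      where
      ∈-concatWith : ∀ A (S : ∀ {a} → a ∈ A → List 𝔸) {a b} (p : a ∈ A) →
                     b ∈ S p → b ∈ concat (mapWith∈ A S)
      ∈-concatWith (_ ∷ _) S (here refl) b∈ = ∈-++⁺ˡ b∈
      ∈-concatWith (_ ∷ A) S (there p)   b∈ =
        ∈-++⁺ʳ (S (here refl)) (∈-concatWith A (S ∘ there) p b∈)

    -- Precomposition γ ∘ i
    infixl 9 _◃_
    _◃_ : ∀ {P Q : Pred 𝔸 ℓ} → StarFun Q → Injection P Q → StarFun P
    γ ◃ i = record
      { app        = λ a p → app γ (fun i a p) (mem i a p)
      ; irrelevant = λ a p p′ → app-cong γ _ _ (fun-irrelevant i a p p′)
      ; fresh      = λ p q a≢b → fresh γ _ _ (a≢b ∘ injective i p q)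
      }

    StarFunctor : Functor (Op 𝕀) Nom
    StarFunctor = record
      { F₀     = Star
      ; F₁     = λ i → record
        { func        = record
          { to   = _◃ i
          ; cong = λ e a p → e (fun i a p) (mem i a p)
          }
        ; equivariant = λ _ _ _ _ → Y.≈-refl
        }
      ; F-cong = λ e γ a p → app-cong γ _ _ (e a p)
      ; F-id   = λ _ _ _ → Y.≈-refl
      ; F-∘    = λ _ _ _ _ _ → Y.≈-refl
      }

  open StarFun

  -- Postcomposition v ∘ γ
  infixr 9 _▹_
  _▹_ : ∀ {Y Y′ P} → EquivariantMap Y Y′ → StarFun Y P → StarFun Y′ P
  v ▹ γ = record
    { app        = λ a p → to v (app γ a p)
    ; irrelevant = λ a p p′ → EquivariantMap.cong v (irrelevant γ a p p′)
    ; fresh      = λ p q a≢b → EquivariantMap.#-to v (fresh γ p q a≢b)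
    }

  ψ : Functor (Op 𝕀) Nom
  ψ = StarFunctor 𝔸ₙ

  module ψ = Functor ψ

  ----------------------------------------------------------------------
  -- The integrand: contravariant in A and covariant in B,
  -- (A , B) ↦ Nom(𝔸^{*B} , X) · Y^{*A}

  integrand : NominalSet → NominalSet → Functor (Op 𝕀 ×ᶜ 𝕀) Nom
  integrand X Y = record
    { F₀     = λ (A , B) → Nom[ ψ.F₀ B , X ] • Y*.F₀ A
    ; F₁     = λ (i , j) → record
      { func        = record
        { to   = λ (f , γ) → f ∘ⁿ ψ.F₁ j , to (Y*.F₁ i) γ
        ; cong = λ { {_ , γ} {_ , δ} (e , e′) →
            (λ x → e (to (ψ.F₁ j) x)) , EquivariantMap.cong (Y*.F₁ i) {γ} {δ} e′ }
        }
      ; equivariant = λ π (f , γ) →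
          (λ _ → X.≈-refl) , EquivariantMap.equivariant (Y*.F₁ i) π γ
      }
    ; F-cong = λ { {f = i , j} {g = i′ , j′} (e , e′) (f , γ) →
        (λ x → EquivariantMap.cong f (ψ.F-cong {f = j} {g = j′} e′ x)) ,
        Y*.F-cong {f = i} {g = i′} e γ }
    ; F-id   = λ (f , γ) →
        (λ x → EquivariantMap.cong f (ψ.F-id x)) , Y*.F-id γ
    ; F-∘    = λ (i , j) (i′ , j′) (f , γ) →
        (λ x → EquivariantMap.cong f (ψ.F-∘ j′ j x)) , Y*.F-∘ i i′ γ
    }
    where
    module X  = NominalSet X
    module Y* = Functor (StarFunctor Y)

  integrand-map : ∀ {X X′ Y Y′} → EquivariantMap X X′ → EquivariantMap Y Y′ → ∀ A →
                  EquivariantMap (Functor.F₀ (integrand X Y) A) (Functor.F₀ (integrand X′ Y′) A)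
  integrand-map {X′ = X′} {Y′ = Y′} u v A = record
    { func        = record
      { to   = λ (f , γ) → u ∘ⁿ f , v ▹ γ
      ; cong = λ (e , e′) →
          (λ x → EquivariantMap.cong u (e x)) , λ a p → EquivariantMap.cong v (e′ a p)
      }
    ; equivariant = λ π (f , γ) →
        (λ _ → NominalSet.≈-refl X′) , λ a p → EquivariantMap.equivariant v π (app γ a p)
    }

  ----------------------------------------------------------------------
  -- {(x , γ) ∣ x ∈ X , γ ∈ Y^{*supp x}} / ∼

  module _ (X Y : NominalSet) where
    private
      module X = NominalSet X
      module Y = NominalSet Y
      module Y* {x : X.Carrier} = PermSet (StarPermSet Y (X.supp x))

    Pair : Set ℓ
    Pair = Σ[ x ∈ X.Carrier ] StarFun Y (X.supp x)

    permInj : ∀ π {x x′} → x′ X.≈ π X.· x → Injection (X.supp x) (X.supp x′)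
    permInj π e = record
      { fun            = λ a _ → π ⟨$⟩ a
      ; mem            = X.supp-· π e
      ; fun-irrelevant = λ _ _ _ → refl
      ; injective      = λ {a} {b} _ _ πa≡πb →
          ≡.trans (≡.sym (inverseˡ π a))
                  (≡.trans (≡.cong (π ⟨$⟩⁻¹_) πa≡πb) (inverseˡ π b))
      }

    -- (π · x , γ) ∼ (x , γπ), closed under the equalities of X and Y^{*supp x};
    -- the group laws make this an equivalence relation already.
    infix 4 _∼_
    _∼_ : Pair → Pair → Set ℓ
    (x′ , γ′) ∼ (x , γ) =
      ∃[ π ] Σ[ e ∈ x′ X.≈ π X.· x ] _◃_ Y γ′ (permInj π e) Y*.≈ γ

    ∼-isEquivalence : IsEquivalence _∼_
    ∼-isEquivalence = record
      { refl  = λ { {x , γ} →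
          idₚ , X.≈-sym (X.·-id x) , λ a p → irrelevant γ a _ p }
      ; sym   = λ { {x′ , γ′} {x , γ} (π , e , h) →
          π ⁻¹ₚ ,
          X.≈-sym (X.≈-trans (X.·-congʳ (π ⁻¹ₚ) e) (X.act-inverseˡ π x)) ,
          λ a p → Y.≈-trans (Y.≈-sym (h _ _)) (app-cong γ′ _ p (inverseʳ π a)) }
      ; trans = λ { {x₁ , γ₁} {x₂ , γ₂} {x₃ , γ₃} (π , e , h) (σ , e′ , h′) →
          π ∘ₚ σ ,
          X.≈-trans e (X.≈-trans (X.·-congʳ π e′) (X.≈-sym (X.·-∘ π σ x₃))) ,
          λ a p → Y.≈-trans (irrelevant γ₁ _ _ _)
                    (Y.≈-trans (h (σ ⟨$⟩ a) (X.supp-· σ e′ a p)) (h′ a p)) }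
      }

    infixr 8 _⋄_
    _⋄_ : PermSet
    _⋄_ = record
      { setoid = record
        { Carrier       = Pair
        ; _≈_           = _∼_
        ; isEquivalence = ∼-isEquivalence
        }
      ; _·_    = λ π (x , γ) → x , π Y*.· γ
      ; ·-cong = λ { {π} {σ} {x , γ} {y , δ} p (τ , e , h) →
          τ , e , λ a q → Y.·-cong {π} {σ} p (h a q) }
      ; ·-id   = λ (x , γ) → ≈⇒∼ (idₚ Y*.· γ) γ (Y*.·-id {x} γ)
      ; ·-∘    = λ π σ (x , γ) → ≈⇒∼ ((π ∘ₚ σ) Y*.· γ) (π Y*.· (σ Y*.· γ)) (Y*.·-∘ {x} π σ γ)
      }
      where
      ≈⇒∼ : ∀ {x} (γ δ : StarFun Y (X.supp x)) → γ Y*.≈ δ → (x , γ) ∼ (x , δ)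
      ≈⇒∼ {x} γ _ e =
        idₚ , X.≈-sym (X.·-id x) , λ a p → Y.≈-trans (irrelevant γ a _ p) (e a p)

  module Tensor (⋄-finitelySupported : ∀ X Y → PermSet.FinitelySupported (X ⋄ Y)) where

    infixr 8 _⊠_
    _⊠_ : NominalSet → NominalSet → NominalSet
    X ⊠ Y = record
      { permSet           = X ⋄ Y
      ; finitelySupported = ⋄-finitelySupported X Y
      }

    -- x[γ] ↦ (u x)[v ∘ γ restricted to supp (u x)]
    ⊠-map : ∀ {X X′ Y Y′} → EquivariantMap X X′ → EquivariantMap Y Y′ →
            EquivariantMap (X ⊠ Y) (X′ ⊠ Y′)
    ⊠-map {X} {X′} {Y} {Y′} u v = record
      { func        = record
        { to   = λ (x , γ) → to u x , _◃_ Y′ (v ▹ γ) (inclusion (u.supp-to x))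
        ; cong = λ { {x′ , γ′} {x , γ} (π , e , h) →
            π , X′.≈-trans (u.cong e) (u.equivariant π x) ,
            λ a p → v.cong (Y.≈-trans (irrelevant γ′ _ _ _) (h a (u.supp-to x p))) }
        }
      ; equivariant = λ π (x , γ) →
          idₚ , X′.≈-sym (X′.·-id (to u x)) , λ a p →
          Y′.≈-trans (v.equivariant π _)
                     (Y′.·-congʳ π (v.cong (irrelevant γ a _ _)))
      }
      where
      module u  = EquivariantMap u
      module v  = EquivariantMap v
      module X′ = NominalSet X′
      module Y  = NominalSet Y
      module Y′ = NominalSet Y′

{-# OPTIONS --safe #-}

-- Every equivariant f : 𝔸^{*A} → X is determined by x = f(ι), where ι is the
-- inclusion A ⊆ 𝔸, because each element of 𝔸^{*A} is π · ι for a finite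
-- permutation π; conversely each x supported by A arises in this way from the
-- map π · ι ↦ π · x.  Hence the coend cowedge sends (f , γ) to the class of f(ι)
-- and the restriction of γ to supp f(ι) ⊆ A, and a cowedge V factors through it by
-- evaluating V at the finite set supp x.  For the supports: a permutation fixing
-- x[γ] permutes ⋃ supp γ(a), so a name of that union outside a support S of x[γ]
-- could be swapped with a fresh name, a contradiction.
module Submission where

open import Defs
open import Axiom.ExcludedMiddle using (ExcludedMiddle)
open import Data.Empty using (⊥-elim)
open import Data.List.Base using (List; []; _∷_; _++_; filter)
open import Data.List.Membership.Propositional using (_∈_; _∉_)
open import Data.List.Membership.Propositional.Properties
  using (∈-++⁺ˡ; ∈-++⁺ʳ; ∈-++⁻; ∈-filter⁺; ∈-filter⁻; finite)
open import Data.List.Relation.Unary.Any using (here; there)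
open import Data.Nat.Base using (ℕ)
open import Data.Product.Base using (Σ; Σ-syntax; ∃-syntax; _×_; _,_; proj₁; proj₂)
open import Data.Sum.Base using (inj₁; inj₂)
open import Function.Base using (id; _∘_)
open import Function.Bundles using (_↔_; mk↔ₛ′)
open import Function.Properties.Inverse using (↔-sym; ↔⇒↣)
open import Level using (Level)
open import Relation.Binary.PropositionalEquality as ≡ using (_≡_; _≢_; refl)
import Relation.Binary.Reasoning.Setoid as SetoidReasoning
open import Relation.Nullary using (¬_; Dec; yes; no)
open import Relation.Nullary.Decidable using (decidable-stable)
open import Relation.Unary using (Pred; _⊆_; _≐_; ⋃)

module _ {ℓ : Level} (em : ExcludedMiddle ℓ) (𝔸 : Set ℓ) (𝔸↔ℕ : 𝔸 ↔ ℕ) where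
  open Nominal 𝔸
  open Perm using (_⟨$⟩_; _⟨$⟩⁻¹_; inverseˡ; inverseʳ)
  open EquivariantMap using (to; cong; equivariant)
  open StarFun
  open Injection

  -- Fresh names and transpositions.

  _≟_ : (a b : 𝔸) → Dec (a ≡ b)
  a ≟ b = em

  -- If no name lay outside L, then L would contain the whole image of an injection from ℕ, which
  -- `finite` excludes.
  fresh-name : ∀ L → ∃[ c ] c ∉ L
  fresh-name L = decidable-stable em λ none →
    finite (↔⇒↣ (↔-sym 𝔸↔ℕ)) L λ _ → decidable-stable em λ c∉L → none (_ , c∉L)

  transpose : 𝔸 → 𝔸 → 𝔸 → 𝔸
  transpose a b c with c ≟ a | c ≟ b
  ... | yes _ | _     = b
  ... | no _  | yes _ = a
  ... | no _  | no _  = c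

  transpose-left : ∀ a b → transpose a b a ≡ b
  transpose-left a b with a ≟ a | a ≟ b
  ... | yes _  | _ = refl
  ... | no a≢a | _ = ⊥-elim (a≢a refl)

  transpose-right : ∀ a b → transpose a b b ≡ a
  transpose-right a b with b ≟ a | b ≟ b
  ... | yes b≡a | _      = b≡a
  ... | no _    | yes _  = refl
  ... | no _    | no b≢b = ⊥-elim (b≢b refl)

  transpose-fixes : ∀ {a b c} → c ≢ a → c ≢ b → transpose a b c ≡ c
  transpose-fixes {a} {b} {c} c≢a c≢b with c ≟ a | c ≟ b
  ... | yes c≡a | _       = ⊥-elim (c≢a c≡a)
  ... | no _    | yes c≡b = ⊥-elim (c≢b c≡b)
  ... | no _    | no _    = refl

  transpose-involutive : ∀ a b c → transpose a b (transpose a b c) ≡ c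
  transpose-involutive a b c with c ≟ a | c ≟ b
  ... | yes c≡a | _       = ≡.trans (transpose-right a b) (≡.sym c≡a)
  ... | no _    | yes c≡b = ≡.trans (transpose-left a b) (≡.sym c≡b)
  ... | no c≢a  | no c≢b  = transpose-fixes c≢a c≢b

  swap : 𝔸 → 𝔸 → Perm
  swap a b = record
    { bijection = mk↔ₛ′ (transpose a b) (transpose a b)
        (transpose-involutive a b) (transpose-involutive a b)
    ; finite    = a ∷ b ∷ [] , λ c∉ →
        transpose-fixes (c∉ ∘ here) (c∉ ∘ there ∘ here)
    }

  swap-fixes : ∀ {a b c L} → a ∉ L → b ∉ L → c ∈ L → swap a b ⟨$⟩ c ≡ c
  swap-fixes a∉L b∉L c∈L =
    transpose-fixes (λ { refl → a∉L c∈L }) (λ { refl → b∉L c∈L })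

  perm-injective : ∀ π {a b} → π ⟨$⟩ a ≡ π ⟨$⟩ b → a ≡ b
  perm-injective π {a} {b} e =
    ≡.trans (≡.sym (inverseˡ π a)) (≡.trans (≡.cong (π ⟨$⟩⁻¹_) e) (inverseˡ π b))

  -- Least supports

  module _ (X : PermSet) where
    open PermSet X

    Supports-mono : ∀ {S T x} → (∀ {a} → a ∈ S → a ∈ T) → Supports S x → Supports T x
    Supports-mono S⊆T S-supp π fix = S-supp π (fix ∘ S⊆T)

    -- The permutation σ⁻¹π fixes S pointwise and hence fixes x.
    agree-on-support : ∀ {S x} → Supports S x → ∀ π σ →
                       (∀ {a} → a ∈ S → π ⟨$⟩ a ≡ σ ⟨$⟩ a) → π · x ≈ σ · x
    agree-on-support {x = x} S-supp π σ agree = begin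
      π · x                ≈⟨ act-inverseʳ σ (π · x) ⟨
      σ · σ ⁻¹ₚ · π · x    ≈⟨ ·-congʳ σ (·-∘ (σ ⁻¹ₚ) π x) ⟨
      σ · (σ ⁻¹ₚ ∘ₚ π) · x ≈⟨ ·-congʳ σ (S-supp (σ ⁻¹ₚ ∘ₚ π) λ {a} a∈S →
        ≡.trans (≡.cong (σ ⟨$⟩⁻¹_) (agree a∈S)) (inverseˡ σ a)) ⟩
      σ · x                ∎
      where open SetoidReasoning setoid

    -- With c fresh, the swap (a c) fixes x because a and c lie outside T, and
    -- conjugating π by it yields a permutation fixing a as well.
    remove-superfluous : ∀ {a S T x} → Supports (a ∷ S) x → Supports T x → a ∉ T →
                         Supports S x
    remove-superfluous {a} {S} {T} {x} aS-supp T-supp a∉T π fix = begin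
      π · x                     ≈⟨ act-inverseˡ τ (π · x) ⟨
      τ ⁻¹ₚ · τ · π · x         ≈⟨ ·-congʳ (τ ⁻¹ₚ) (·-congʳ τ (·-congʳ π τx≈x)) ⟨
      τ ⁻¹ₚ · τ · π · τ · x     ≈⟨ ·-congʳ (τ ⁻¹ₚ) (·-congʳ τ (·-∘ π τ x)) ⟨
      τ ⁻¹ₚ · τ · (π ∘ₚ τ) · x  ≈⟨ ·-congʳ (τ ⁻¹ₚ) (·-∘ τ (π ∘ₚ τ) x) ⟨
      τ ⁻¹ₚ · (τ ∘ₚ π ∘ₚ τ) · x ≈⟨ ·-congʳ (τ ⁻¹ₚ) (aS-supp (τ ∘ₚ π ∘ₚ τ) fix′) ⟩
      τ ⁻¹ₚ · x                 ≈⟨ ·-congʳ (τ ⁻¹ₚ) τx≈x ⟨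
      τ ⁻¹ₚ · τ · x             ≈⟨ act-inverseˡ τ x ⟩
      x                         ∎
      where
      open SetoidReasoning setoid
      -- Outside `M` the permutation π is the identity, so it fixes `c`; this is why τπτ fixes `a`.
      M : List 𝔸
      M = proj₁ (Perm.finite π)
      c : 𝔸
      c = proj₁ (fresh-name (S ++ T ++ M))
      c∉ : c ∉ S ++ T ++ M
      c∉ = proj₂ (fresh-name (S ++ T ++ M))
      τ : Perm
      τ = swap a c
      τx≈x : τ · x ≈ x
      τx≈x = T-supp τ (swap-fixes a∉T (c∉ ∘ ∈-++⁺ʳ S ∘ ∈-++⁺ˡ))
      fix-a : τ ⟨$⟩ π ⟨$⟩ τ ⟨$⟩ a ≡ a
      fix-a = ≡.trans
        (≡.cong (λ b → τ ⟨$⟩ π ⟨$⟩ b) (transpose-left a c))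
        (≡.trans (≡.cong (τ ⟨$⟩_) (proj₂ (Perm.finite π) (c∉ ∘ ∈-++⁺ʳ S ∘ ∈-++⁺ʳ T)))
                 (transpose-right a c))
      fix-S : ∀ {b} → Dec (b ≡ a) → b ∈ S → τ ⟨$⟩ π ⟨$⟩ τ ⟨$⟩ b ≡ b
      fix-S     (yes refl) _   = fix-a
      fix-S {b} (no b≢a)   b∈S = ≡.trans (≡.cong (λ b → τ ⟨$⟩ π ⟨$⟩ b) τb≡b)
                               (≡.trans (≡.cong (τ ⟨$⟩_) (fix b∈S)) τb≡b)
        where
        τb≡b : τ ⟨$⟩ b ≡ b
        τb≡b = transpose-fixes b≢a λ { refl → c∉ (∈-++⁺ˡ b∈S) }
      fix′ : ∀ {b} → b ∈ a ∷ S → τ ⟨$⟩ π ⟨$⟩ τ ⟨$⟩ b ≡ b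
      fix′ (here refl)     = fix-a
      fix′ {b} (there b∈S) = fix-S (b ≟ a) b∈S

    -- Classically, a name outside an intersection of supports is missed by one of them.
    ∉supp⇒avoiding-support : ∀ {x a} → ¬ supp x a → ∃[ T ] Supports T x × a ∉ T
    ∉supp⇒avoiding-support a∉supp = decidable-stable em λ none →
      a∉supp λ T T-supp → decidable-stable em λ a∉T → none (T , T-supp , a∉T)

    -- `S` holds the names still to be examined, `K` those known to lie in every support. A name
    -- outside `supp x` is dropped, any other moves to `K`; once `S` is empty, `K` is itself a
    -- support.
    supp-isLeast-++ : ∀ {x} S K → Supports (S ++ K) x → (∀ {a} → a ∈ K → supp x a) →
                      IsLeastFiniteSupport (supp x) x
    supp-isLeast-++ [] K K-supp K⊆supp =
      K , ((λ a∈supp → a∈supp K K-supp) , K⊆supp) , K-supp , λ T T-supp a∈ → a∈ T T-supp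
    supp-isLeast-++ {x} (a ∷ S) K S-supp K⊆supp with em {P = supp x a}
    ... | no a∉supp =
      let T , T-supp , a∉T = ∉supp⇒avoiding-support a∉supp in
      supp-isLeast-++ S K (remove-superfluous S-supp T-supp a∉T) K⊆supp
    ... | yes a∈supp = supp-isLeast-++ S (a ∷ K)
      (Supports-mono move S-supp)
      λ { (here refl) → a∈supp ; (there b∈K) → K⊆supp b∈K }
      where
      move : ∀ {b} → b ∈ a ∷ S ++ K → b ∈ S ++ a ∷ K
      move (here refl) = ∈-++⁺ʳ S (here refl)
      move (there b∈) with ∈-++⁻ S b∈
      ... | inj₁ b∈S = ∈-++⁺ˡ b∈S
      ... | inj₂ b∈K = ∈-++⁺ʳ S (there b∈K)

    supp-isLeast : ∀ {S x} → Supports S x → IsLeastFiniteSupport (supp x) x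
    supp-isLeast {S} S-supp = supp-isLeast-++ S []
      (Supports-mono ∈-++⁺ˡ S-supp) λ ()

  module _ (X : NominalSet) (x : NominalSet.Carrier X) where
    open NominalSet X

    private
      least : IsLeastFiniteSupport (supp x) x
      least = supp-isLeast permSet (proj₂ (finitelySupported x))

    -- Objects of `𝕀` are lists, whereas `supp x` is a predicate; this is the same set as an object
    -- of `𝕀`.
    suppList : List 𝔸
    suppList = proj₁ least

    supp⊆suppList : supp x ⊆ (_∈ suppList)
    supp⊆suppList = proj₁ (proj₁ (proj₂ least))

    suppList⊆supp : (_∈ suppList) ⊆ supp x
    suppList⊆supp = proj₂ (proj₁ (proj₂ least))

    suppList-supports : Supports suppList x
    suppList-supports = proj₁ (proj₂ (proj₂ least))

  -- Injections into 𝔸 and equivariant maps out of 𝔸^{*A}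

  -- If a support missed `a`, swapping `a` with a fresh name would fix that support pointwise and
  -- yet move `a`.
  name∈supp : ∀ a → NominalSet.supp 𝔸ₙ a a
  name∈supp a S S-supp = decidable-stable em λ a∉S →
    let c , c∉ = fresh-name (a ∷ S) in
    c∉ (here (≡.trans (≡.sym (transpose-left a c))
                      (S-supp (swap a c) (swap-fixes a∉S (c∉ ∘ there)))))

  -- Distinct arguments have values with disjoint supports, while every name lies in its own
  -- support.
  app-injective : ∀ {P} (β : StarFun 𝔸ₙ P) {a b} (p : P a) (q : P b) →
                  app β a p ≡ app β b q → a ≡ b
  app-injective β {a} {b} p q e = decidable-stable em λ a≢b →
    fresh β p q a≢b
      ( ≡.subst (λ c → NominalSet.supp 𝔸ₙ c (app β b q)) (≡.sym e) (name∈supp (app β b q))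
      , name∈supp (app β b q))

  -- The generic element ι, whose orbit is all of 𝔸^{*A}.
  nameInclusion : ∀ A → StarFun 𝔸ₙ (_∈ A)
  nameInclusion A = record
    { app        = λ a _ → a
    ; irrelevant = λ _ _ _ → refl
    ; fresh      = λ {a} {b} _ _ a≢b (c∈a , c∈b) →
        a≢b (≡.trans (≡.sym (supp-name c∈a)) (supp-name c∈b))
    }
    where
    supp-name : ∀ {a c} → NominalSet.supp 𝔸ₙ a c → c ≡ a
    supp-name {a} c∈a with c∈a (a ∷ []) (λ _ fix → fix (here refl))
    ... | here c≡a = c≡a

  infix 4 _Extends_
  _Extends_ : ∀ {P} → Perm → StarFun 𝔸ₙ P → Set ℓ
  π Extends β = ∀ a p → π ⟨$⟩ a ≡ app β a p

  -- Induction on A: π extends β on the tail, and a swap then corrects the value at `a`. The swap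
  -- leaves the values at other names alone because π and β are both injective.
  extension : ∀ A (β : StarFun 𝔸ₙ (_∈ A)) → ∃[ π ] π Extends β
  extension []      β = idₚ , λ _ ()
  extension (a ∷ A) β = swap (π ⟨$⟩ a) β[a] ∘ₚ π , extends
    where
    β[a] : 𝔸
    β[a] = app β a (here refl)
    ext : ∃[ π ] π Extends _◃_ 𝔸ₙ β (inclusion there)
    ext = extension A (_◃_ 𝔸ₙ β (inclusion there))
    π : Perm
    π = proj₁ ext
    extends : (swap (π ⟨$⟩ a) β[a] ∘ₚ π) Extends β
    extends b p = case (b ≟ a) p
      where
      case : Dec (b ≡ a) → (p : b ∈ a ∷ A) → transpose (π ⟨$⟩ a) β[a] (π ⟨$⟩ b) ≡ app β b p
      -- `p` may point to a later copy of `a` in the list; irrelevance gives the same value of β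
      -- there.
      case (yes refl) p           =
        ≡.trans (transpose-left (π ⟨$⟩ a) β[a]) (irrelevant β a (here refl) p)
      case (no b≢a)   (here b≡a)  = ⊥-elim (b≢a b≡a)
      case (no b≢a)   (there b∈A) = ≡.trans
        (transpose-fixes (b≢a ∘ perm-injective π)
          (λ πb≡βa → b≢a (app-injective β (there b∈A) (here refl)
                           (≡.trans (≡.sym (proj₂ ext b b∈A)) πb≡βa))))
        (proj₂ ext b b∈A)

  module _ (X : NominalSet) where
    open NominalSet X

    -- Permutations agreeing on A act alike on x, so the choice made by `extension` is immaterial;
    -- congruence and equivariance both rest on this.
    orbitMap : ∀ A x → Supports A x → EquivariantMap (ψ.F₀ A) X
    orbitMap A x A-supp = record
      { func        = record
        { to   = λ β → proj₁ (extension A β) · x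
        ; cong = λ {β} {δ} e → agree-on-support permSet A-supp _ _ λ {a} a∈A →
            ≡.trans (proj₂ (extension A β) a a∈A)
                    (≡.trans (e a a∈A) (≡.sym (proj₂ (extension A δ) a a∈A)))
        }
      ; equivariant = λ π β → ≈-trans
          (agree-on-support permSet A-supp _ (π ∘ₚ proj₁ (extension A β)) λ {a} a∈A →
            ≡.trans (proj₂ (extension A _) a a∈A)
                    (≡.cong (π ⟨$⟩_) (≡.sym (proj₂ (extension A β) a a∈A))))
          (·-∘ π (proj₁ (extension A β)) x)
      }

    orbitMap-extends : ∀ {A x} (A-supp : Supports A x) β π → π Extends β →
                       to (orbitMap A x A-supp) β ≈ π · x
    orbitMap-extends {A} A-supp β π ext = agree-on-support permSet A-supp _ π λ {a} a∈A →
      ≡.trans (proj₂ (extension A β) a a∈A) (≡.sym (ext a a∈A))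

    -- When π extends β, β equals π · ι; thus f is determined by its value at ι.
    equivariant-extends : ∀ {A} (f : EquivariantMap (ψ.F₀ A) X) β π → π Extends β →
                          to f β ≈ π · to f (nameInclusion A)
    equivariant-extends {A} f β π ext = ≈-trans
      (cong f {β} {NominalSet._·_ (ψ.F₀ A) π (nameInclusion A)} λ a p → ≡.sym (ext a p))
      (equivariant f π (nameInclusion A))

    -- A supports ι, and equivariant maps do not enlarge supports. This allows γ on A to be
    -- restricted to the support of f(ι).
    supp-generic : ∀ {A} (f : EquivariantMap (ψ.F₀ A) X) →
                   supp (to f (nameInclusion A)) ⊆ (_∈ A)
    supp-generic {A} f a∈ =
      EquivariantMap.supp-to f (nameInclusion A) a∈ A λ _ fix a a∈A → fix a∈A

  -- The coend

  module _ (X Y : NominalSet) where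
    private
      module X = NominalSet X
      module Y = NominalSet Y
      module Y* {x : X.Carrier} = PermSet (StarPermSet Y (X.supp x))
      module X⋄Y = PermSet (X ⋄ Y)

    ≈⇒∼ : ∀ {x y} (γ : StarFun Y (X.supp x)) (δ : StarFun Y (X.supp y)) → x X.≈ y →
          (∀ a p q → app γ a p Y.≈ app δ a q) → (x , γ) X⋄Y.≈ (y , δ)
    ≈⇒∼ γ δ x≈y e = idₚ , X.≈-trans x≈y (X.≈-sym (X.·-id _)) , λ a q → e a _ q

    restrict : ∀ x → StarFun Y (X.supp x) → StarFun Y (_∈ suppList X x)
    restrict x γ = _◃_ Y γ (inclusion (suppList⊆supp X x))

    -- Finite supports are at hand for stars over lists, so γ is transferred to `suppList` and back.
    starSupport : ∀ {x} (γ : StarFun Y (X.supp x)) → ∃[ S ] Y*.Supports S γ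
    starSupport {x} γ =
      let S , S-supp = NominalSet.finitelySupported (Star Y (suppList X x)) (restrict x γ)
      in S , λ π fix a p → Y.≈-trans
        (Y.·-congʳ π (irrelevant γ a p _))
        (Y.≈-trans (S-supp π fix a (supp⊆suppList X x p)) (irrelevant γ a _ p))

    Supports-tensor : ∀ {x S} (γ : StarFun Y (X.supp x)) →
                      Y*.Supports S γ → X⋄Y.Supports S (x , γ)
    Supports-tensor {x} γ S-supp π fix =
      ≈⇒∼ (π Y*.· γ) γ X.≈-refl λ a p q →
        Y.≈-trans (S-supp π fix a p) (irrelevant γ a p q)

    tensor-finitelySupported : X⋄Y.FinitelySupported
    tensor-finitelySupported (x , γ) =
      proj₁ (starSupport γ) , Supports-tensor γ (proj₂ (starSupport γ))

  open Tensor tensor-finitelySupported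

  module _ (X Y : NominalSet) where
    private
      module X = NominalSet X
      module Y = NominalSet Y
      module X⋄Y = PermSet (X ⋄ Y)

    genericPair : ∀ A → EquivariantMap (ψ.F₀ A) X → StarFun Y (_∈ A) → Pair X Y
    genericPair A f γ =
      to f (nameInclusion A) , _◃_ Y γ (inclusion (supp-generic X f))

    -- Evaluating f ∘ ψ(j) at the inclusion of B gives f(j), which is π · f(ι) for any π extending
    -- j. The two pairs are therefore related by π, since γπ and γj agree on the support of f(ι).
    genericPair-dinatural :
      ∀ {A B} (j : A 𝕀.⇒ B) f γ →
      genericPair A f (_◃_ Y γ j) X⋄Y.≈ genericPair B (f ∘ⁿ ψ.F₁ j) γ
    genericPair-dinatural {A} {B} j f γ =
      let β       = _◃_ 𝔸ₙ (nameInclusion B) j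
          π , ext = extension A β
      in X⋄Y.≈-sym {genericPair B (f ∘ⁿ ψ.F₁ j) γ} {genericPair A f (_◃_ Y γ j)}
           (π , equivariant-extends X f β π ext ,
            λ a p → app-cong γ _ _ (ext a (supp-generic X f p)))

    tensorCowedge : Cowedge (integrand X Y) (X ⊠ Y)
    tensorCowedge = record
      { ω         = λ A → record
        { func        = record
          { to   = λ (f , γ) → genericPair A f γ
          ; cong = λ { {f , γ} {g , δ} (e , e′) →
              ≈⇒∼ X Y (proj₂ (genericPair A f γ)) (proj₂ (genericPair A g δ))
                (e (nameInclusion A)) λ a p q → Y.≈-trans (irrelevant γ a _ _) (e′ a _) }
          }
        ; equivariant = λ π (f , γ) →
            ≈⇒∼ X Y (proj₂ (genericPair A f (NominalSet._·_ (Star Y A) π γ)))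
              (proj₂ (π X⋄Y.· genericPair A f γ)) X.≈-refl λ a p q →
              Y.·-congʳ π (irrelevant γ a _ _)
        }
      ; dinatural = λ {A} {B} j (f , γ) → X⋄Y.≈-trans
          {genericPair A (f ∘ⁿ ψ.F₁ 𝕀.idm) (_◃_ Y γ j)} {genericPair A f (_◃_ Y γ j)}
          {genericPair B (f ∘ⁿ ψ.F₁ j) γ}
          (≈⇒∼ X Y (proj₂ (genericPair A (f ∘ⁿ ψ.F₁ 𝕀.idm) (_◃_ Y γ j)))
             (proj₂ (genericPair A f (_◃_ Y γ j))) X.≈-refl
             λ a p q → irrelevant (_◃_ Y γ j) a _ _)
          (genericPair-dinatural j f γ)
      }

    -- Universal property: factoring an arbitrary cowedge.

    module _ {Z : NominalSet} (V : Cowedge (integrand X Y) Z) where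
      private
        module Z = NominalSet Z
        module V = Cowedge V

      ω-cong : ∀ A {f g : EquivariantMap (ψ.F₀ A) X} {γ δ : StarFun Y (_∈ A)} →
               f ≈ⁿ g → (∀ a p → app γ a p Y.≈ app δ a p) →
               to (V.ω A) (f , γ) Z.≈ to (V.ω A) (g , δ)
      ω-cong A {f} {g} {γ} {δ} e e′ = cong (V.ω A) {f , γ} {g , δ} (e , e′)

      genericMap : ∀ x → EquivariantMap (ψ.F₀ (suppList X x)) X
      genericMap x = orbitMap X (suppList X x) x (suppList-supports X x)

      factorTo : X⋄Y.Carrier → Z.Carrier
      factorTo (x , γ) = to (V.ω (suppList X x)) (genericMap x , restrict X Y x γ)

      -- A permutation π relating the two pairs restricts to an injection `j` from supp x to supp
      -- x′, and dinaturality of V along `j` identifies the two values.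
      factorTo-cong : ∀ {p q} → p X⋄Y.≈ q → factorTo p Z.≈ factorTo q
      factorTo-cong {x′ , γ′} {x , γ} (π , e , h) = Z.≈-sym (begin
        to (V.ω S) (genericMap x , restrict X Y x γ)
          ≈⟨ ω-cong S (λ _ → X.≈-refl) (λ a p →
               Y.≈-trans (Y.≈-sym (h a _)) (irrelevant γ′ _ _ _)) ⟩
        to (V.ω S) (genericMap x , _◃_ Y (restrict X Y x′ γ′) j)
          ≈⟨ ω-cong S (λ _ → X.≈-refl) (λ _ _ → Y.≈-refl) ⟩
        to (V.ω S) (genericMap x ∘ⁿ ψ.F₁ 𝕀.idm , _◃_ Y (restrict X Y x′ γ′) j)
          ≈⟨ V.dinatural j (genericMap x , restrict X Y x′ γ′) ⟩
        to (V.ω S′) (genericMap x ∘ⁿ ψ.F₁ j , _◃_ Y (restrict X Y x′ γ′) 𝕀.idm)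
          ≈⟨ ω-cong S′ maps (λ _ _ → Y.≈-refl) ⟩
        to (V.ω S′) (genericMap x′ , restrict X Y x′ γ′) ∎)
        where
        open SetoidReasoning Z.setoid
        S S′ : List 𝔸
        S  = suppList X x
        S′ = suppList X x′
        j : S 𝕀.⇒ S′
        j = inclusion (supp⊆suppList X x′) ∘ᵢ permInj X Y π e
              ∘ᵢ inclusion (suppList⊆supp X x)
        -- If ρ extends β, then ρπ extends β ∘ j, and ρ · π · x equals ρ · x′.
        maps : (genericMap x ∘ⁿ ψ.F₁ j) ≈ⁿ genericMap x′
        maps β =
          let ρ , ext = extension S′ β in X.≈-trans
            (orbitMap-extends X (suppList-supports X x) (_◃_ 𝔸ₙ β j) (ρ ∘ₚ π)
              λ a p → ext (π ⟨$⟩ a) (mem j a p))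
            (X.≈-trans (X.·-∘ ρ π x) (X.·-congʳ ρ (X.≈-sym e)))

      factorMap : EquivariantMap (X ⊠ Y) Z
      factorMap = record
        { func        = record { to = factorTo ; cong = λ {p} {q} → factorTo-cong {p} {q} }
        ; equivariant = λ π (x , γ) → Z.≈-trans
            (ω-cong (suppList X x) (λ _ → X.≈-refl) (λ _ _ → Y.≈-refl))
            (equivariant (V.ω (suppList X x)) π (genericMap x , restrict X Y x γ))
        }

      -- Dinaturality of V along the inclusion of supp f(ι) into A.
      factorMap-commutes : ∀ A → (factorMap ∘ⁿ Cowedge.ω tensorCowedge A) ≈ⁿ V.ω A
      factorMap-commutes A (f , γ) = begin
        to (V.ω S) (genericMap x , restrict X Y x (_◃_ Y γ (inclusion (supp-generic X f))))
          ≈⟨ ω-cong S (λ _ → X.≈-refl) (λ a p → irrelevant γ a _ _) ⟩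
        to (V.ω S) (genericMap x ∘ⁿ ψ.F₁ 𝕀.idm , _◃_ Y γ i)
          ≈⟨ V.dinatural i (genericMap x , γ) ⟩
        to (V.ω A) (genericMap x ∘ⁿ ψ.F₁ i , _◃_ Y γ 𝕀.idm)
          ≈⟨ ω-cong A maps (λ _ _ → Y.≈-refl) ⟩
        to (V.ω A) (f , γ) ∎
        where
        open SetoidReasoning Z.setoid
        x : X.Carrier
        x = to f (nameInclusion A)
        S : List 𝔸
        S = suppList X x
        i : S 𝕀.⇒ A
        i = inclusion (supp-generic X f ∘ suppList⊆supp X x)
        -- Both sides send ρ · ι to ρ · f(ι).
        maps : (genericMap x ∘ⁿ ψ.F₁ i) ≈ⁿ f
        maps β =
          let ρ , ext = extension A β in X.≈-trans
            (orbitMap-extends X (suppList-supports X x) (_◃_ 𝔸ₙ β i) ρ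
              λ a p → ext a (mem i a p))
            (X.≈-sym (equivariant-extends X f β ρ ext))

      -- Since `genericMap x` sends ι to x, every x[γ] is a value of the cowedge at supp x, so k is
      -- determined by its composites with the cowedge.
      factorMap-unique : (k : EquivariantMap (X ⊠ Y) Z) →
                         (∀ A → (k ∘ⁿ Cowedge.ω tensorCowedge A) ≈ⁿ V.ω A) → k ≈ⁿ factorMap
      factorMap-unique k k∘ω≈V (x , γ) = Z.≈-trans
        (cong k {x , γ} {generic} (≈⇒∼ X Y γ (proj₂ generic)
          (X.≈-sym (X.≈-trans
            (orbitMap-extends X (suppList-supports X x) (nameInclusion (suppList X x)) idₚ
              λ _ _ → refl)
            (X.·-id x)))
          λ a p q → irrelevant γ a _ _))
        (k∘ω≈V (suppList X x) (genericMap x , restrict X Y x γ))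
        where
        generic : Pair X Y
        generic = genericPair (suppList X x) (genericMap x) (restrict X Y x γ)

    tensor-isCoend : IsCoend (integrand X Y) (X ⊠ Y) tensorCowedge
    tensor-isCoend = record
      { factor   = factorMap
      ; commutes = factorMap-commutes
      ; unique   = factorMap-unique
      }

  -- Both sides have first component u(f(ι)), and their second components differ only in membership
  -- proofs.
  tensorCowedge-natural :
    ∀ {X X′ Y Y′} (u : EquivariantMap X X′) (v : EquivariantMap Y Y′) A →
    (⊠-map u v ∘ⁿ Cowedge.ω (tensorCowedge X Y) A) ≈ⁿ
    (Cowedge.ω (tensorCowedge X′ Y′) A ∘ⁿ integrand-map u v (A , A))
  tensorCowedge-natural {X} {X′} {Y} {Y′} u v A (f , γ) = ≈⇒∼ X′ Y′
    (proj₂ (to (⊠-map u v) (genericPair X Y A f γ)))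
    (proj₂ (genericPair X′ Y′ A (u ∘ⁿ f) (v ▹ γ)))
    (NominalSet.≈-refl X′) λ a _ _ → cong v (irrelevant γ a _ _)

  -- Supports in X ⋄ Y

  module _ (X Y : NominalSet) {x : NominalSet.Carrier X}
           (γ : StarFun Y (NominalSet.supp X x)) where
    private
      module X = NominalSet X
      module Y = NominalSet Y
      module Y* = PermSet (StarPermSet Y (X.supp x))
      module X⋄Y = PermSet (X ⋄ Y)

    valueSupports : Pred 𝔸 ℓ
    valueSupports = ⋃ (Σ 𝔸 (X.supp x)) (λ (a , p) → Y.supp (app γ a p))

    valueSupports⊆supp : valueSupports ⊆ Y*.supp γ
    valueSupports⊆supp ((a , p) , b∈) S S-supp = b∈ S λ π fix → S-supp π fix a p

    -- A finite support T of γ remains one after filtering by `valueSupports`: each γ(a) is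
    -- supported by its own least support, whose names lie in T and pass the filter.
    supp⊆valueSupports : Y*.supp γ ⊆ valueSupports
    supp⊆valueSupports b∈ = proj₂ (∈-filter⁻ inValues {xs = T} (b∈ (filter inValues T)
      λ π fix a p → suppList-supports Y (app γ a p) π λ c∈ →
        let c∈value = (a , p) , suppList⊆supp Y (app γ a p) c∈ in
        fix (∈-filter⁺ inValues (valueSupports⊆supp c∈value T T-supp) c∈value)))
      where
      T : List 𝔸
      T = proj₁ (starSupport X Y γ)
      T-supp : Y*.Supports T γ
      T-supp = proj₂ (starSupport X Y γ)
      inValues : ∀ c → Dec (valueSupports c)
      inValues c = em

    valueSupports⊆tensor-supp : valueSupports ⊆ X⋄Y.supp (x , γ)
    valueSupports⊆tensor-supp {b} b∈@((a , p) , b∈γa) S S-supp =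
      decidable-stable em λ b∉S →
      let T , T-supp = starSupport X Y γ
          c , c∉     = fresh-name (S ++ T)
          τ          = swap b c
          -- Since τ fixes the class x[γ], some σ satisfies τ · γ(σa) = γ(a). As b lies in supp
          -- γ(a), the fresh name c = τ⁻¹b lies in supp γ(σa), hence in T, which it was chosen to
          -- avoid.
          σ , e , h  = S-supp τ (swap-fixes b∉S (c∉ ∘ ∈-++⁺ˡ))
          σa∈        = X.supp-· σ e a p
          γσa        = app γ (σ ⟨$⟩ a) σa∈
          τb∈        = Y.supp-· (τ ⁻¹ₚ) {x′ = γσa}
            (Y.≈-trans (Y.≈-sym (Y.act-inverseˡ τ γσa)) (Y.·-congʳ (τ ⁻¹ₚ) (h a p))) b b∈γa
          c∈         = ≡.subst (Y.supp γσa) (transpose-left b c) τb∈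
      in c∉ (∈-++⁺ʳ S (valueSupports⊆supp ((σ ⟨$⟩ a , σa∈) , c∈) T T-supp))

    tensor-supp : X⋄Y.supp (x , γ) ≐ Y*.supp γ
    tensor-supp =
      (λ b∈ S S-supp → b∈ S (Supports-tensor X Y γ S-supp)) ,
      valueSupports⊆tensor-supp ∘ supp⊆valueSupports

theorem6p8 :
  ∀ {ℓ : Level} → ExcludedMiddle ℓ → (𝔸 : Set ℓ) → 𝔸 ↔ ℕ →
  let open Nominal 𝔸 in
  Σ[ fs ∈ (∀ X Y → PermSet.FinitelySupported (X ⋄ Y)) ]
  let open Tensor fs in
    -- X ⊠ Y, that is X ⋄ Y as a nominal set, is the coend, naturally in X and Y
    (Σ[ W ∈ (∀ X Y → Cowedge (integrand X Y) (X ⊠ Y)) ]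
      ((∀ X Y → IsCoend (integrand X Y) (X ⊠ Y) (W X Y)) ×
       (∀ {X X′ Y Y′} (u : EquivariantMap X X′) (v : EquivariantMap Y Y′) (A : 𝕀.Obj) →
          (⊠-map u v ∘ⁿ Cowedge.ω (W X Y) A) ≈ⁿ
          (Cowedge.ω (W X′ Y′) A ∘ⁿ integrand-map u v (A , A)))))
    ×
    (∀ (X Y : NominalSet) (x : NominalSet.Carrier X)
       (γ : StarFun Y (NominalSet.supp X x)) →
       let module X   = NominalSet X
           module Y   = NominalSet Y
           module Y*  = PermSet (StarPermSet Y (X.supp x))
           module X⋄Y = PermSet (X ⋄ Y)
       in
       (∀ π → (π X⋄Y.· (x , γ)) X⋄Y.≈ (x , π Y*.· γ)) ×
       (X⋄Y.supp (x , γ) ≐ Y*.supp γ) ×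
       (Y*.supp γ ≐ ⋃ (Σ 𝔸 (X.supp x)) (λ (a , p) → Y.supp (StarFun.app γ a p))) ×
       X⋄Y.IsLeastFiniteSupport (X⋄Y.supp (x , γ)) (x , γ))
theorem6p8 em 𝔸 𝔸↔ℕ =
  tensor-finitelySupported em 𝔸 𝔸↔ℕ ,
  (tensorCowedge em 𝔸 𝔸↔ℕ , tensor-isCoend em 𝔸 𝔸↔ℕ ,
   tensorCowedge-natural em 𝔸 𝔸↔ℕ) ,
  λ X Y x γ →
    (λ π → PermSet.≈-refl (X ⋄ Y) {PermSet._·_ (X ⋄ Y) π (x , γ)}) ,
    tensor-supp em 𝔸 𝔸↔ℕ X Y γ ,
    (supp⊆valueSupports em 𝔸 𝔸↔ℕ X Y γ , valueSupports⊆supp em 𝔸 𝔸↔ℕ X Y γ) ,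
    supp-isLeast em 𝔸 𝔸↔ℕ (X ⋄ Y) {x = x , γ}
      (proj₂ (tensor-finitelySupported em 𝔸 𝔸↔ℕ X Y (x , γ)))
  where open Nominal 𝔸
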